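{- Let $\Phi$ be a consistent theory over RPL$\forall$. For every RPL$\forall$-Horn clause $\varphi$ without free variables, if $|\varphi|_{\Phi}=1$, then $\|\varphi\|_{\mathbf{T}^{\Phi}}=1$, where $\langle[0,1]_{\mathrm{RPL}},\mathbf{T}^{\Phi}\rangle$ is the term structure associated to $\Phi$.
   Context: **Logic.** RPL$\forall$ (Rational Pavelka predicate logic) is first-order Łukasiewicz logic with a truth constant $\overline r$ for each rational $r\in[0,1]$. Conventions: $\neg\varphi:=\varphi\to\overline 0$, $\varphi\&\psi:=\neg(\varphi\to\neg\psi)$, $\varphi\leftrightarrow\psi:=(\varphi\to\psi)\&(\psi\to\varphi)$, $(\exists x)\varphi:=\neg(\forall x)\neg\varphi$. On $[0,1]$: $a\to b=\min\{1,1-a+b\}$ and $a\& b=\max\{0,a+b-1\}$. Every predicate language contains a binary predicate symbol $\approx$. Axioms: $\varphi\to(\psi\to\varphi)$; $(\varphi\to\psi)\to((\psi\to\xi)\to(\varphi\to\xi))$; $(\neg\psi\to\neg\varphi)\to(\varphi\to\psi)$; $((\varphi\to\psi)\to\psi)\to((\psi\to\varphi)\to\varphi)$; $(\overline r\to\overline s)\leftrightarrow\overline{r\to s}$; $(\overline r\&\overline s)\leftrightarrow\overline{r\& s}$; $(\forall x)\varphi(x)\to\varphi(t)$ for $t$ substitutable for $x$ in $\varphi$; $(\forall x)(\xi\to\varphi)\to(\xi\to(\forall x)\varphi)$ for $x$ not free in $\xi$; and the similarity and congruence axioms: (S1) $(\forall x)\,x\approx x$; (S2) $(\forall x)(\forall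 y)(x\approx y\to y\approx x)$; (S3) $(\forall x)(\forall y)(\forall z)(x\approx y\& y\approx z\to x\approx z)$; (C1) for each $n$-ary function symbol $F$, the universal closure of $x_1\approx y_1\&\cdots\& x_n\approx y_n\to F(x_1,\dots,x_n)\approx F(y_1,\dots,y_n)$; (C2) for each $n$-ary predicate symbol $P$, the universal closure of $x_1\approx y_1\&\cdots\& x_n\approx y_n\to(P(x_1,\dots,x_n)\leftrightarrow P(y_1,\dots,y_n))$. Rules: Modus Ponens and Generalization (from $\varphi$ infer $(\forall x)\varphi$). $\vdash$ denotes provability in this system. A theory is a set of sentences; $\Phi$ is consistent if $\Phi\not\vdash\overline 0$. **Semantics.** A structure $\langle[0,1]_{\mathrm{RPL}},\mathbf M\rangle$ consists of a non-empty domain $M$, a function $P_{\mathbf M}:M^n\to[0,1]$ for each $n$-ary predicate symbol $P$, and a function $F_{\mathbf M}:M^n\to M$ for each $n$-ary function symbol $F$. An $\mathbf M$-evaluation $v$ maps variables to $M$. Values $\|t\|_{\mathbf M,v}\in M$ of terms and truth values $\|\varphi\|_{\mathbf M,v}\in[0,1]$ of formulas are defined recursively as usual, with $\overline r$ having value $r$, connectives interpreted by the operations above on the standard real interval $[0,1]$, $\forall$ by infimum and $\exists$ by supremum over $M$. Put $\|\varphi\|_{\mathbf M}=\inf_v\|\varphi\|_{\mathbf M,v}$. **Term structure.** The provability degree is $|\varphi|_\Phi=\sup\{r\in[0,1]\cap\mathbb Q\mid\Phi\vdash\overline r\to\varphi\}$. For terms (possibly containing variables), $t_1\sim t_2$ iff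 $|t_1\approx t_2|_\Phi=1$; this is an equivalence relation and $\overline t$ denotes the class of $t$. The term structure associated to $\Phi$ has domain $T^\Phi$ the set of all $\sim$-classes of terms, with $F_{\mathbf T^\Phi}(\overline{t_1},\dots,\overline{t_n})=\overline{F(t_1,\dots,t_n)}$ and $P_{\mathbf T^\Phi}(\overline{t_1},\dots,\overline{t_n})=|P(t_1,\dots,t_n)|_\Phi$ (these are well defined). **Horn clauses.** An evaluated formula $(\varphi,r)$ is the formula $\overline r\to\varphi$, where $r\in[0,1]$ is rational and $\varphi$ contains no truth constants other than $\overline 0,\overline 1$; it is atomic if $\varphi$ is atomic. A basic RPL$\forall$-Horn formula is a formula $(\alpha_1,r_1)\&\cdots\&(\alpha_n,r_n)\to(\beta,s)$, where $n$ is a natural number and all $(\alpha_i,r_i)$ and $(\beta,s)$ are evaluated atomic formulas; when $n=0$ it is just $(\beta,s)$. A quantifier-free RPL$\forall$-Horn formula is $\phi_1\&\cdots\&\phi_m$ with each $\phi_i$ a basic RPL$\forall$-Horn formula. An RPL$\forall$-Horn clause is $Q\gamma$, where $Q$ is a (possibly empty) string of universal quantifiers and $\gamma$ is a quantifier-free RPL$\forall$-Horn formula. -}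

module Defs where

open import Data.Bool.Base using (if_then_else_)
open import Data.Empty using (⊥; ⊥-elim)
open import Data.Fin.Base as Fin using (Fin; toℕ)
open import Data.List.Base using (List; []; _∷_; foldl)
open import Data.List.Relation.Unary.All using (All; []; _∷_)
open import Data.Nat.Base as ℕ using (ℕ; zero; suc)
import Data.Nat.Properties as ℕₚ
open import Data.Product using (Σ; Σ-syntax; ∃; ∃-syntax; ∃₂; _×_; _,_; proj₁; proj₂)
open import Data.Rational using (ℚ; 0ℚ; 1ℚ; _+_; _-_; -_; _≤_; _<_; _⊓_; _⊔_; _≤?_)
import Data.Rational.Properties as ℚₚ
open import Data.Rational.Solver using (module +-*-Solver)
open import Data.Sum using (_⊎_; inj₁; inj₂)
open import Data.Unit using (⊤; tt)
open import Data.Vec.Base using (Vec; []; _∷_; tabulate; zipWith; toList)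
open import Data.Vec.Properties using (tabulate-cong)
open import Data.Vec.Relation.Binary.Pointwise.Inductive using (Pointwise; []; _∷_)
open import Data.Vec.Relation.Unary.Any using (Any; here; there)
open import Function using (_∘_)
open import Level using (0ℓ)
open import Relation.Binary.Bundles using (Setoid)
open import Relation.Binary.Definitions using (tri<; tri≈; tri>)
open import Relation.Binary.PropositionalEquality
open import Relation.Nullary using (¬_; Dec; yes; no; does)
open import Relation.Nullary.Decidable using (decidable-stable; recompute)

------------------------------------------------------------------------
-- Real numbers

-- A real number x is given by the closed lower cut { q | q ≤ x } of
-- rationals.  Stability under double negation holds of every predicate in
-- classical logic; requiring it makes suprema of arbitrary bounded sets
-- available without assuming excluded middle.  Under excluded middle,
-- these cuts are exactly the classical real numbers.

record ℝ : Set₁ where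
  field
    Below     : ℚ → Set
    down      : ∀ {p q} → p ≤ q → Below q → Below p
    closed    : ∀ {q} → (∀ p → p < q → Below p) → Below q
    stable    : ∀ {q} → ¬ ¬ Below q → Below q
    inhabited : ∃[ l ] Below l
    bounded   : ∃[ u ] (∀ q → Below q → q ≤ u)

open ℝ public

infix 4 _≤ʳ_ _≈ʳ_

_≤ʳ_ : ℝ → ℝ → Set
x ≤ʳ y = ∀ q → Below x q → Below y q

_≈ʳ_ : ℝ → ℝ → Set
x ≈ʳ y = x ≤ʳ y × y ≤ʳ x

≤-approx : ∀ {q r} → (∀ p → p < q → p ≤ r) → q ≤ r
≤-approx {q} {r} h = ℚₚ.≮⇒≥ λ r<q →
  let (m , r<m , m<q) = ℚₚ.<-dense r<q
  in ℚₚ.<-irrefl refl (ℚₚ.<-≤-trans r<m (h m m<q))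

≤-stable : ∀ {p q} → ¬ ¬ (p ≤ q) → p ≤ q
≤-stable {p} {q} = decidable-stable (p ≤? q)

fromℚ : ℚ → ℝ
fromℚ r = record
  { Below     = _≤ r
  ; down      = ℚₚ.≤-trans
  ; closed    = ≤-approx
  ; stable    = ≤-stable
  ; inhabited = r , ℚₚ.≤-refl
  ; bounded   = r , λ _ q≤r → q≤r
  }

infixl 6 _+ʳ_ _-ʳ_
infixl 7 _⊓ʳ_
infix  8 -ʳ_

_+ʳ_ : ℝ → ℝ → ℝ
x +ʳ y = record
  { Below     = λ q → ∀ p → p < q → ¬ ¬ S p
  ; down      = λ p≤q h p' p'<p → h p' (ℚₚ.<-≤-trans p'<p p≤q)
  ; closed    = λ h p p<q → let (m , p<m , m<q) = ℚₚ.<-dense p<q in h m m<q p p<m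
  ; stable    = λ h p p<q k → h λ g → g p p<q k
  ; inhabited = let (a , xa) = inhabited x ; (b , yb) = inhabited y in
                a + b , λ p p<a+b k → k (a , b , xa , yb , ℚₚ.<⇒≤ p<a+b)
  ; bounded   = let (u , xu) = bounded x ; (v , yv) = bounded y in
                u + v , λ q h → ≤-approx λ p p<q → ≤-stable λ k → h p p<q
                  λ (a , b , xa , yb , p≤a+b) →
                    k (ℚₚ.≤-trans p≤a+b (ℚₚ.+-mono-≤ (xu a xa) (yv b yb)))
  }
  where
  S : ℚ → Set
  S p = ∃₂ λ a b → Below x a × Below y b × p ≤ a + b

-- q ≤ - x  iff  x ≤ - q  iff  p ≤ - q for all rational p ≤ x.

-ʳ_ : ℝ → ℝ
-ʳ x = record
  { Below     = λ q → ∀ p → Below x p → q ≤ - p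
  ; down      = λ p≤q h s xs → ℚₚ.≤-trans p≤q (h s xs)
  ; closed    = λ h s xs → ≤-approx λ p p<q → h p p<q s xs
  ; stable    = λ h s xs → ≤-stable λ k → h λ g → k (g s xs)
  ; inhabited = let (u , xu) = bounded x in - u , λ p xp → ℚₚ.neg-antimono-≤ (xu p xp)
  ; bounded   = let (l , xl) = inhabited x in - l , λ q h → h l xl
  }

_-ʳ_ : ℝ → ℝ → ℝ
x -ʳ y = x +ʳ -ʳ y

_⊓ʳ_ : ℝ → ℝ → ℝ
x ⊓ʳ y = record
  { Below     = λ q → Below x q × Below y q
  ; down      = λ p≤q (xq , yq) → down x p≤q xq , down y p≤q yq
  ; closed    = λ h → closed x (λ p p<q → proj₁ (h p p<q)) , closed y (λ p p<q → proj₂ (h p p<q))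
  ; stable    = λ h → stable x (λ k → h (k ∘ proj₁)) , stable y (λ k → h (k ∘ proj₂))
  ; inhabited = let (a , xa) = inhabited x ; (b , yb) = inhabited y in
                a ⊓ b , down x (ℚₚ.p⊓q≤p a b) xa , down y (ℚₚ.p⊓q≤q a b) yb
  ; bounded   = let (u , xu) = bounded x in u , λ q (xq , _) → xu q xq
  }

------------------------------------------------------------------------
-- The real unit interval

record 𝕀 : Set₁ where
  field
    real : ℝ
    0≤   : fromℚ 0ℚ ≤ʳ real
    ≤1   : real ≤ʳ fromℚ 1ℚ

open 𝕀 public using (real)

infix 4 _≤ᴵ_ _≈ᴵ_
infixr 6 _⇒ᴵ_

_≤ᴵ_ : 𝕀 → 𝕀 → Set
a ≤ᴵ b = real a ≤ʳ real b

_≈ᴵ_ : 𝕀 → 𝕀 → Set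
a ≈ᴵ b = real a ≈ʳ real b

_⇒ᴵ_ : 𝕀 → 𝕀 → 𝕀
a ⇒ᴵ b = record
  { real = fromℚ 1ℚ ⊓ʳ ((fromℚ 1ℚ -ʳ real a) +ʳ real b)
  ; 0≤   = λ q q≤0 → ℚₚ.≤-trans q≤0 0≤1 , λ p p<q k →
             k (0ℚ , 0ℚ , 0≤1-a , 𝕀.0≤ b 0ℚ ℚₚ.≤-refl , ℚₚ.<⇒≤ (ℚₚ.<-≤-trans p<q q≤0))
  ; ≤1   = λ q (q≤1 , _) → q≤1
  }
  where
  0≤1 : 0ℚ ≤ 1ℚ
  0≤1 = ℚₚ.nonNegative⁻¹ 1ℚ
  0≤1-a : Below (fromℚ 1ℚ -ʳ real a) 0ℚ
  0≤1-a p p<0 k = k (1ℚ , - 1ℚ , ℚₚ.≤-refl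
                    , (λ s as → ℚₚ.neg-antimono-≤ (𝕀.≤1 a s as)) , ℚₚ.<⇒≤ p<0)

module _ {I : Set} where

  ⋀ : (I → 𝕀) → 𝕀
  ⋀ x = record
    { real = record
      { Below     = λ q → q ≤ 1ℚ × (∀ i → Below (real (x i)) q)
      ; down      = λ p≤q (q≤1 , h) → ℚₚ.≤-trans p≤q q≤1 , λ i → down (real (x i)) p≤q (h i)
      ; closed    = λ h → ≤-approx (λ p p<q → proj₁ (h p p<q))
                        , λ i → closed (real (x i)) λ p p<q → proj₂ (h p p<q) i
      ; stable    = λ h → ≤-stable (λ k → h (k ∘ proj₁))
                        , λ i → stable (real (x i)) λ k → h λ g → k (proj₂ g i)
      ; inhabited = 0ℚ , ℚₚ.nonNegative⁻¹ 1ℚ , λ i → 𝕀.0≤ (x i) 0ℚ ℚₚ.≤-refl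
      ; bounded   = 1ℚ , λ q → proj₁
      }
    ; 0≤ = λ q q≤0 → ℚₚ.≤-trans q≤0 (ℚₚ.nonNegative⁻¹ 1ℚ) , λ i → 𝕀.0≤ (x i) q q≤0
    ; ≤1 = λ q → proj₁
    }

  -- The alternative p ≤ 0 makes the supremum of the empty family 0.

  ⋁ : (I → 𝕀) → 𝕀
  ⋁ x = record
    { real = record
      { Below     = λ q → ∀ p → p < q → ¬ ¬ (p ≤ 0ℚ ⊎ ∃[ i ] Below (real (x i)) p)
      ; down      = λ p≤q h p' p'<p → h p' (ℚₚ.<-≤-trans p'<p p≤q)
      ; closed    = λ h p p<q → let (m , p<m , m<q) = ℚₚ.<-dense p<q in h m m<q p p<m
      ; stable    = λ h p p<q k → h λ g → g p p<q k
      ; inhabited = 0ℚ , λ p p<0 k → k (inj₁ (ℚₚ.<⇒≤ p<0))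
      ; bounded   = 1ℚ , below-1
      }
    ; 0≤ = λ q q≤0 p p<q k → k (inj₁ (ℚₚ.<⇒≤ (ℚₚ.<-≤-trans p<q q≤0)))
    ; ≤1 = below-1
    }
    where
    below-1 : ∀ q → (∀ p → p < q → ¬ ¬ (p ≤ 0ℚ ⊎ ∃[ i ] Below (real (x i)) p)) → q ≤ 1ℚ
    below-1 q h = ≤-approx λ p p<q → ≤-stable λ k → h p p<q λ where
      (inj₁ p≤0)     → k (ℚₚ.≤-trans p≤0 (ℚₚ.nonNegative⁻¹ 1ℚ))
      (inj₂ (i , b)) → k (𝕀.≤1 (x i) p b)

  ⋀-lower : ∀ x i → ⋀ x ≤ᴵ x i
  ⋀-lower x i q (_ , h) = h i

  ⋀-greatest : ∀ x a → (∀ i → a ≤ᴵ x i) → a ≤ᴵ ⋀ x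
  ⋀-greatest x a h q aq = 𝕀.≤1 a q aq , λ i → h i q aq

  ⋁-upper : ∀ x i → x i ≤ᴵ ⋁ x
  ⋁-upper x i q xq p p<q k = k (inj₂ (i , down (real (x i)) (ℚₚ.<⇒≤ p<q) xq))

  ⋁-least : ∀ x a → (∀ i → x i ≤ᴵ a) → ⋁ x ≤ᴵ a
  ⋁-least x a h q xq = closed (real a) λ p p<q → stable (real a) λ k → xq p p<q λ where
    (inj₁ p≤0)     → k (𝕀.0≤ a p p≤0)
    (inj₂ (i , b)) → k (h i p b)

------------------------------------------------------------------------
-- The rational unit interval

-- The bounds are irrelevant, so that truth constants with equal values are
-- propositionally equal.

record ℚ₀₁ : Set where
  constructor mk
  field
    value : ℚ
    .0≤   : 0ℚ ≤ value
    .≤1   : value ≤ 1ℚ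

open ℚ₀₁ public using (value)

lower-bound : ∀ r → 0ℚ ≤ value r
lower-bound (mk q 0≤q _) = recompute (0ℚ ≤? q) 0≤q

upper-bound : ∀ r → value r ≤ 1ℚ
upper-bound (mk q _ q≤1) = recompute (q ≤? 1ℚ) q≤1

0₀₁ 1₀₁ : ℚ₀₁
0₀₁ = mk 0ℚ ℚₚ.≤-refl (ℚₚ.nonNegative⁻¹ 1ℚ)
1₀₁ = mk 1ℚ (ℚₚ.nonNegative⁻¹ 1ℚ) ℚₚ.≤-refl

infixr 6 _⇒ᵠ_
infixr 7 _&ᵠ_

_⇒ᵠ_ : ℚ₀₁ → ℚ₀₁ → ℚ₀₁
r ⇒ᵠ s = mk (1ℚ ⊓ (1ℚ - value r + value s))
  (ℚₚ.⊓-glb (ℚₚ.nonNegative⁻¹ 1ℚ)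
    (ℚₚ.+-mono-≤ {0ℚ} {1ℚ - value r} {0ℚ} {value s}
      (ℚₚ.+-monoʳ-≤ 1ℚ (ℚₚ.neg-antimono-≤ (upper-bound r))) (lower-bound s)))
  (ℚₚ.p⊓q≤p 1ℚ (1ℚ - value r + value s))

_&ᵠ_ : ℚ₀₁ → ℚ₀₁ → ℚ₀₁
r &ᵠ s = mk (0ℚ ⊔ (value r + value s - 1ℚ))
  (ℚₚ.p≤p⊔q 0ℚ (value r + value s - 1ℚ))
  (ℚₚ.⊔-lub (ℚₚ.nonNegative⁻¹ 1ℚ)
    (ℚₚ.+-monoˡ-≤ (- 1ℚ) (ℚₚ.+-mono-≤ (upper-bound r) (upper-bound s))))

fromℚ₀₁ : ℚ₀₁ → 𝕀
fromℚ₀₁ r = record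
  { real = fromℚ (value r)
  ; 0≤   = λ q q≤0 → ℚₚ.≤-trans q≤0 (lower-bound r)
  ; ≤1   = λ q q≤r → ℚₚ.≤-trans q≤r (upper-bound r)
  }

𝟏 : 𝕀
𝟏 = fromℚ₀₁ 1₀₁

------------------------------------------------------------------------
-- Syntax

record Language : Set₁ where
  field
    Func : ℕ → Set
    Pred : ℕ → Set
    ≈    : Pred 2

open Language public

variable
  L : Language
  n : ℕ

data Term (L : Language) : Set where
  var : ℕ → Term L
  fun : ∀ {n} → Func L n → Vec (Term L) n → Term L

infixr 6 _⟶_

data Formula (L : Language) : Set where
  rel   : ∀ {n} → Pred L n → Vec (Term L) n → Formula L
  const : ℚ₀₁ → Formula L
  _⟶_   : Formula L → Formula L → Formula L
  all   : ℕ → Formula L → Formula L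

infix  9 ¬̇_
infix  8 _≐_ _≐*_
infixr 7 _&_
infix  5 _⟷_

_≐_ : Term L → Term L → Formula L
_≐_ {L} t u = rel (≈ L) (t ∷ u ∷ [])

⊥̇ ⊤̇ : Formula L
⊥̇ = const 0₀₁
⊤̇ = const 1₀₁

¬̇_ : Formula L → Formula L
¬̇ φ = φ ⟶ ⊥̇

_&_ _⟷_ : Formula L → Formula L → Formula L
φ & ψ = ¬̇ (φ ⟶ ¬̇ ψ)
φ ⟷ ψ = (φ ⟶ ψ) & (ψ ⟶ φ)

ex : ℕ → Formula L → Formula L
ex x φ = ¬̇ all x (¬̇ φ)

data _occursIn_ {L : Language} (x : ℕ) : Term L → Set where
  var : x occursIn var x
  fun : {f : Func L n} {ts : Vec (Term L) n} → Any (x occursIn_) ts → x occursIn fun f ts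

data _freeIn_ {L : Language} (x : ℕ) : Formula L → Set where
  rel : {P : Pred L n} {ts : Vec (Term L) n} → Any (x occursIn_) ts → x freeIn rel P ts
  ⟶ˡ  : ∀ {φ ψ} → x freeIn φ → x freeIn (φ ⟶ ψ)
  ⟶ʳ  : ∀ {φ ψ} → x freeIn ψ → x freeIn (φ ⟶ ψ)
  all : ∀ {y φ} → x ≢ y → x freeIn φ → x freeIn all y φ

Sentence : Formula L → Set
Sentence φ = ∀ x → ¬ x freeIn φ

infix 10 _[_≔_]ᵗ _[_≔_]ᵗˢ _[_≔_]

_[_≔_]ᵗ  : Term L → ℕ → Term L → Term L
_[_≔_]ᵗˢ : Vec (Term L) n → ℕ → Term L → Vec (Term L) n

var y    [ x ≔ t ]ᵗ = if does (x ℕₚ.≟ y) then t else var y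
fun f us [ x ≔ t ]ᵗ = fun f (us [ x ≔ t ]ᵗˢ)

[]       [ x ≔ t ]ᵗˢ = []
(u ∷ us) [ x ≔ t ]ᵗˢ = u [ x ≔ t ]ᵗ ∷ us [ x ≔ t ]ᵗˢ

-- Replaces the free occurrences of x, without renaming bound variables.

_[_≔_] : Formula L → ℕ → Term L → Formula L
rel P ts [ x ≔ t ] = rel P (ts [ x ≔ t ]ᵗˢ)
const r  [ x ≔ t ] = const r
(φ ⟶ ψ)  [ x ≔ t ] = φ [ x ≔ t ] ⟶ ψ [ x ≔ t ]
all y φ  [ x ≔ t ] = if does (x ℕₚ.≟ y) then all y φ else all y (φ [ x ≔ t ])

Substitutable : Term L → ℕ → Formula L → Set
Substitutable t x (rel P ts) = ⊤
Substitutable t x (const r)  = ⊤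
Substitutable t x (φ ⟶ ψ)  = Substitutable t x φ × Substitutable t x ψ
Substitutable t x (all y φ)  =
  ¬ x freeIn all y φ ⊎ (¬ y occursIn t × Substitutable t x φ)

-- all< k φ is (∀ 0) … (∀ k-1) φ.

all< : ℕ → Formula L → Formula L
all< zero    φ = φ
all< (suc k) φ = all< k (all k φ)

-- φ₁ , … , φₙ ⊸ ψ is φ₁ & ⋯ & φₙ ⟶ ψ, which for n = 0 is read as ψ.

infixr 6 _⊸_

_⊸_ : List (Formula L) → Formula L → Formula L
[]       ⊸ ψ = ψ
(φ ∷ φs) ⊸ ψ = foldl _&_ φ φs ⟶ ψ

_≐*_ : Vec (Term L) n → Vec (Term L) n → List (Formula L)
ts ≐* us = toList (zipWith _≐_ ts us)

-- The variables with indices k , … , k + n - 1.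

vars : ∀ k n → Vec (Term L) n
vars k n = tabulate λ i → var (k ℕ.+ toℕ i)

------------------------------------------------------------------------
-- Provability

record Theory (L : Language) : Set₁ where
  field
    _∋_      : Formula L → Set
    sentence : ∀ {φ} → _∋_ φ → Sentence φ

open Theory public

-- The similarity and congruence axioms are stated for fixed distinct
-- variables; their alphabetic variants are derivable.

infix 4 _⊢_

data _⊢_ {L : Language} (Φ : Theory L) : Formula L → Set where

  hyp : ∀ {φ} → Φ ∋ φ → Φ ⊢ φ

  Ł1 : ∀ φ ψ   → Φ ⊢ φ ⟶ (ψ ⟶ φ)
  Ł2 : ∀ φ ψ ξ → Φ ⊢ (φ ⟶ ψ) ⟶ ((ψ ⟶ ξ) ⟶ (φ ⟶ ξ))
  Ł3 : ∀ φ ψ   → Φ ⊢ (¬̇ ψ ⟶ ¬̇ φ) ⟶ (φ ⟶ ψ)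
  Ł4 : ∀ φ ψ   → Φ ⊢ ((φ ⟶ ψ) ⟶ ψ) ⟶ ((ψ ⟶ φ) ⟶ φ)

  const-⟶ : ∀ r s → Φ ⊢ (const r ⟶ const s) ⟷ const (r ⇒ᵠ s)
  const-& : ∀ r s → Φ ⊢ (const r & const s) ⟷ const (r &ᵠ s)

  ∀1 : ∀ x φ t → Substitutable t x φ → Φ ⊢ all x φ ⟶ φ [ x ≔ t ]
  ∀2 : ∀ x ξ φ → ¬ x freeIn ξ → Φ ⊢ all x (ξ ⟶ φ) ⟶ (ξ ⟶ all x φ)

  S1 : Φ ⊢ all 0 (var 0 ≐ var 0)
  S2 : Φ ⊢ all 0 (all 1 (var 0 ≐ var 1 ⟶ var 1 ≐ var 0))
  S3 : Φ ⊢ all 0 (all 1 (all 2 (var 0 ≐ var 1 & var 1 ≐ var 2 ⟶ var 0 ≐ var 2)))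

  C1 : (F : Func L n) → Φ ⊢ all< (n ℕ.+ n)
         (vars 0 n ≐* vars n n ⊸ fun F (vars 0 n) ≐ fun F (vars n n))
  C2 : (P : Pred L n) → Φ ⊢ all< (n ℕ.+ n)
         (vars 0 n ≐* vars n n ⊸ (rel P (vars 0 n) ⟷ rel P (vars n n)))

  mp  : ∀ {φ ψ} → Φ ⊢ φ → Φ ⊢ φ ⟶ ψ → Φ ⊢ ψ
  gen : ∀ x {φ} → Φ ⊢ φ → Φ ⊢ all x φ

Consistent : Theory L → Set
Consistent Φ = ¬ Φ ⊢ ⊥̇

∣_∣[_] : Formula L → Theory L → 𝕀
∣ φ ∣[ Φ ] = ⋁ {I = Σ[ r ∈ ℚ₀₁ ] Φ ⊢ const r ⟶ φ} (fromℚ₀₁ ∘ proj₁)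

------------------------------------------------------------------------
-- Semantics

-- The domain is a setoid, so that a set of equivalence classes can be
-- represented by its representatives.

record Structure (L : Language) : Set₁ where
  field
    domain : Setoid 0ℓ 0ℓ

  open Setoid domain public renaming (Carrier to ∣M∣; _≈_ to _≈ᴹ_)

  field
    point    : ∣M∣
    ⟦_⟧ᶠ     : Func L n → Vec ∣M∣ n → ∣M∣
    ⟦⟧ᶠ-cong : ∀ (F : Func L n) {ms ms′ : Vec ∣M∣ n} →
               Pointwise _≈ᴹ_ ms ms′ → ⟦ F ⟧ᶠ ms ≈ᴹ ⟦ F ⟧ᶠ ms′
    ⟦_⟧ᴾ     : Pred L n → Vec ∣M∣ n → 𝕀
    ⟦⟧ᴾ-cong : ∀ (P : Pred L n) {ms ms′ : Vec ∣M∣ n} →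
               Pointwise _≈ᴹ_ ms ms′ → ⟦ P ⟧ᴾ ms ≈ᴵ ⟦ P ⟧ᴾ ms′

module Semantics (M : Structure L) where
  open Structure M

  Evaluation : Set
  Evaluation = ℕ → ∣M∣

  _[_↦_] : Evaluation → ℕ → ∣M∣ → Evaluation
  (v [ x ↦ m ]) y = if does (x ℕₚ.≟ y) then m else v y

  ⟦_⟧ᵗ  : Term L → Evaluation → ∣M∣
  ⟦_⟧ᵗˢ : Vec (Term L) n → Evaluation → Vec ∣M∣ n

  ⟦ var x ⟧ᵗ    v = v x
  ⟦ fun F ts ⟧ᵗ v = ⟦ F ⟧ᶠ (⟦ ts ⟧ᵗˢ v)

  ⟦ [] ⟧ᵗˢ     v = []
  ⟦ t ∷ ts ⟧ᵗˢ v = ⟦ t ⟧ᵗ v ∷ ⟦ ts ⟧ᵗˢ v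

  ⟦_⟧ : Formula L → Evaluation → 𝕀
  ⟦ rel P ts ⟧ v = ⟦ P ⟧ᴾ (⟦ ts ⟧ᵗˢ v)
  ⟦ const r ⟧  v = fromℚ₀₁ r
  ⟦ φ ⟶ ψ ⟧    v = ⟦ φ ⟧ v ⇒ᴵ ⟦ ψ ⟧ v
  ⟦ all x φ ⟧  v = ⋀ λ m → ⟦ φ ⟧ (v [ x ↦ m ])

‖_‖ : Formula L → Structure L → 𝕀
‖ φ ‖ M = ⋀ (Semantics.⟦_⟧ M φ)

------------------------------------------------------------------------
-- Substitution into theorems

if-yes : ∀ {A P : Set} {a b : A} (d : Dec P) → P → (if does d then a else b) ≡ a
if-yes (yes _) p = refl
if-yes (no ¬p) p = ⊥-elim (¬p p)

if-no : ∀ {A P : Set} {a b : A} (d : Dec P) → ¬ P → (if does d then a else b) ≡ b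
if-no (yes p) ¬p = ⊥-elim (¬p p)
if-no (no _)  ¬p = refl

infix 10 _⟪_⟫ᵗ _⟪_⟫ᵗˢ _⟪_⟫

_⟪_⟫ᵗ  : Term L → (ℕ → Term L) → Term L
_⟪_⟫ᵗˢ : Vec (Term L) n → (ℕ → Term L) → Vec (Term L) n

var x    ⟪ σ ⟫ᵗ = σ x
fun F ts ⟪ σ ⟫ᵗ = fun F (ts ⟪ σ ⟫ᵗˢ)

[]       ⟪ σ ⟫ᵗˢ = []
(t ∷ ts) ⟪ σ ⟫ᵗˢ = t ⟪ σ ⟫ᵗ ∷ ts ⟪ σ ⟫ᵗˢ

_⟪_⟫ : Formula L → (ℕ → Term L) → Formula L
rel P ts ⟪ σ ⟫ = rel P (ts ⟪ σ ⟫ᵗˢ)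
const r  ⟪ σ ⟫ = const r
(φ ⟶ ψ)  ⟪ σ ⟫ = φ ⟪ σ ⟫ ⟶ ψ ⟪ σ ⟫
all x φ  ⟪ σ ⟫ = all x (φ ⟪ (λ y → if does (x ℕₚ.≟ y) then var y else σ y) ⟫)

data QuantifierFree {L : Language} : Formula L → Set where
  rel   : {P : Pred L n} {ts : Vec (Term L) n} → QuantifierFree (rel P ts)
  const : ∀ {r} → QuantifierFree (const r)
  _⟶_   : ∀ {φ ψ} → QuantifierFree φ → QuantifierFree ψ → QuantifierFree (φ ⟶ ψ)

⟪⟫ᵗ-cong  : ∀ (t : Term L) {σ τ} → (∀ x → x occursIn t → σ x ≡ τ x) → t ⟪ σ ⟫ᵗ ≡ t ⟪ τ ⟫ᵗ
⟪⟫ᵗˢ-cong : ∀ (ts : Vec (Term L) n) {σ τ} →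
            (∀ x → Any (x occursIn_) ts → σ x ≡ τ x) → ts ⟪ σ ⟫ᵗˢ ≡ ts ⟪ τ ⟫ᵗˢ

⟪⟫ᵗ-cong (var x)    h = h x var
⟪⟫ᵗ-cong (fun F ts) h = cong (fun F) (⟪⟫ᵗˢ-cong ts λ x → h x ∘ fun)

⟪⟫ᵗˢ-cong []       h = refl
⟪⟫ᵗˢ-cong (t ∷ ts) h =
  cong₂ _∷_ (⟪⟫ᵗ-cong t λ x → h x ∘ here) (⟪⟫ᵗˢ-cong ts λ x → h x ∘ there)

⟪⟫-cong : ∀ {φ : Formula L} {σ τ} → QuantifierFree φ →
          (∀ x → x freeIn φ → σ x ≡ τ x) → φ ⟪ σ ⟫ ≡ φ ⟪ τ ⟫
⟪⟫-cong (rel {ts = ts}) h = cong (rel _) (⟪⟫ᵗˢ-cong ts λ x → h x ∘ rel)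
⟪⟫-cong const           h = refl
⟪⟫-cong (p ⟶ q)         h =
  cong₂ _⟶_ (⟪⟫-cong p λ x → h x ∘ ⟶ˡ) (⟪⟫-cong q λ x → h x ∘ ⟶ʳ)

⟪var⟫ᵗ  : ∀ (t : Term L) → t ⟪ var ⟫ᵗ ≡ t
⟪var⟫ᵗˢ : ∀ (ts : Vec (Term L) n) → ts ⟪ var ⟫ᵗˢ ≡ ts

⟪var⟫ᵗ (var x)    = refl
⟪var⟫ᵗ (fun F ts) = cong (fun F) (⟪var⟫ᵗˢ ts)

⟪var⟫ᵗˢ []       = refl
⟪var⟫ᵗˢ (t ∷ ts) = cong₂ _∷_ (⟪var⟫ᵗ t) (⟪var⟫ᵗˢ ts)

⟪var⟫ : ∀ {φ : Formula L} → QuantifierFree φ → φ ⟪ var ⟫ ≡ φ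
⟪var⟫ (rel {ts = ts}) = cong (rel _) (⟪var⟫ᵗˢ ts)
⟪var⟫ const           = refl
⟪var⟫ (p ⟶ q)         = cong₂ _⟶_ (⟪var⟫ p) (⟪var⟫ q)

module _ {x : ℕ} {u : Term L} {σ : ℕ → Term L} where

  ⟪⟫-[]ᵗ  : ∀ t → t ⟪ σ ⟫ᵗ [ x ≔ u ]ᵗ ≡ t ⟪ (λ y → σ y [ x ≔ u ]ᵗ) ⟫ᵗ
  ⟪⟫-[]ᵗˢ : ∀ (ts : Vec (Term L) n) →
            ts ⟪ σ ⟫ᵗˢ [ x ≔ u ]ᵗˢ ≡ ts ⟪ (λ y → σ y [ x ≔ u ]ᵗ) ⟫ᵗˢ

  ⟪⟫-[]ᵗ (var y)    = refl
  ⟪⟫-[]ᵗ (fun F ts) = cong (fun F) (⟪⟫-[]ᵗˢ ts)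

  ⟪⟫-[]ᵗˢ []       = refl
  ⟪⟫-[]ᵗˢ (t ∷ ts) = cong₂ _∷_ (⟪⟫-[]ᵗ t) (⟪⟫-[]ᵗˢ ts)

  ⟪⟫-[] : ∀ {φ} → QuantifierFree φ → φ ⟪ σ ⟫ [ x ≔ u ] ≡ φ ⟪ (λ y → σ y [ x ≔ u ]ᵗ) ⟫
  ⟪⟫-[] (rel {ts = ts}) = cong (rel _) (⟪⟫-[]ᵗˢ ts)
  ⟪⟫-[] const           = refl
  ⟪⟫-[] (p ⟶ q)         = cong₂ _⟶_ (⟪⟫-[] p) (⟪⟫-[] q)

module _ {x : ℕ} {u : Term L} where

  []-freshᵗ  : ∀ t → ¬ x occursIn t → t [ x ≔ u ]ᵗ ≡ t
  []-freshᵗˢ : ∀ (ts : Vec (Term L) n) → ¬ Any (x occursIn_) ts → ts [ x ≔ u ]ᵗˢ ≡ ts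

  []-freshᵗ (var y)    h = if-no (x ℕₚ.≟ y) λ { refl → h var }
  []-freshᵗ (fun F ts) h = cong (fun F) ([]-freshᵗˢ ts (h ∘ fun))

  []-freshᵗˢ []       h = refl
  []-freshᵗˢ (t ∷ ts) h = cong₂ _∷_ ([]-freshᵗ t (h ∘ here)) ([]-freshᵗˢ ts (h ∘ there))

  QF-substitutable : ∀ {φ} → QuantifierFree φ → Substitutable u x φ
  QF-substitutable rel     = tt
  QF-substitutable const   = tt
  QF-substitutable (p ⟶ q) = QF-substitutable p , QF-substitutable q

module _ {x : ℕ} where

  []-idᵗ  : ∀ (t : Term L) → t [ x ≔ var x ]ᵗ ≡ t
  []-idᵗˢ : ∀ (ts : Vec (Term L) n) → ts [ x ≔ var x ]ᵗˢ ≡ ts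

  []-idᵗ (var y) with x ℕₚ.≟ y
  ... | yes refl = if-yes (x ℕₚ.≟ x) refl
  ... | no x≢y   = if-no (x ℕₚ.≟ y) x≢y
  []-idᵗ (fun F ts) = cong (fun F) ([]-idᵗˢ ts)

  []-idᵗˢ []       = refl
  []-idᵗˢ (t ∷ ts) = cong₂ _∷_ ([]-idᵗ t) ([]-idᵗˢ ts)

  []-id : ∀ (φ : Formula L) → φ [ x ≔ var x ] ≡ φ
  []-id (rel P ts) = cong (rel P) ([]-idᵗˢ ts)
  []-id (const r)  = refl
  []-id (φ ⟶ ψ)    = cong₂ _⟶_ ([]-id φ) ([]-id ψ)
  []-id (all y φ) with x ℕₚ.≟ y
  ... | yes x≡y = if-yes (x ℕₚ.≟ y) x≡y
  ... | no x≢y  = trans (if-no (x ℕₚ.≟ y) x≢y) (cong (all y) ([]-id φ))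

  id-substitutable : ∀ (φ : Formula L) → Substitutable (var x) x φ
  id-substitutable (rel P ts) = tt
  id-substitutable (const r)  = tt
  id-substitutable (φ ⟶ ψ)    = id-substitutable φ , id-substitutable ψ
  id-substitutable (all y φ) with x ℕₚ.≟ y
  ... | yes refl = inj₁ λ { (all x≢x _) → x≢x refl }
  ... | no x≢y   = inj₂ ((λ { var → x≢y refl }) , id-substitutable φ)

boundᵗ  : ∀ (t : Term L) → ∃[ k ] (∀ x → x occursIn t → x ℕ.< k)
boundᵗˢ : ∀ (ts : Vec (Term L) n) → ∃[ k ] (∀ x → Any (x occursIn_) ts → x ℕ.< k)

boundᵗ (var x)    = suc x , λ { _ var → ℕₚ.≤-refl }
boundᵗ (fun F ts) = let (k , h) = boundᵗˢ ts in k , λ { x (fun p) → h x p }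

boundᵗˢ []       = 0 , λ x ()
boundᵗˢ (t ∷ ts) = let (k , h) = boundᵗ t ; (l , g) = boundᵗˢ ts in k ℕ.⊔ l , λ where
  x (here p)  → ℕₚ.<-≤-trans (h x p) (ℕₚ.m≤m⊔n k l)
  x (there p) → ℕₚ.<-≤-trans (g x p) (ℕₚ.m≤n⊔m k l)

bound : ∀ {φ : Formula L} → QuantifierFree φ → ∃[ k ] (∀ x → x freeIn φ → x ℕ.< k)
bound (rel {ts = ts}) = let (k , h) = boundᵗˢ ts in k , λ { x (rel p) → h x p }
bound const           = 0 , λ x ()
bound (p ⟶ q)         = let (k , h) = bound p ; (l , g) = bound q in k ℕ.⊔ l , λ where
  x (⟶ˡ f) → ℕₚ.<-≤-trans (h x f) (ℕₚ.m≤m⊔n k l)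
  x (⟶ʳ f) → ℕₚ.<-≤-trans (g x f) (ℕₚ.m≤n⊔m k l)

bound-σ : ∀ (σ : ℕ → Term L) k →
          ∃[ N ] (k ℕ.≤ N × (∀ i → i ℕ.< k → ∀ x → x occursIn σ i → x ℕ.< N))
bound-σ σ zero    = 0 , ℕ.z≤n , λ i ()
bound-σ σ (suc k) =
  let (N , k≤N , h) = bound-σ σ k
      (l , g) = boundᵗ (σ k)
  in suc (N ℕ.⊔ l)
   , ℕ.s≤s (ℕₚ.≤-trans k≤N (ℕₚ.m≤m⊔n N l))
   , λ i i<1+k x p → ℕₚ.m<n⇒m<1+n (case-< h g i i<1+k x p)
  where
  case-< : ∀ {N l} → (∀ i → i ℕ.< k → ∀ x → x occursIn σ i → x ℕ.< N) →
           (∀ x → x occursIn σ k → x ℕ.< l) →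
           ∀ i → i ℕ.< suc k → ∀ x → x occursIn σ i → x ℕ.< N ℕ.⊔ l
  case-< {N} {l} h g i i<1+k x p with i ℕₚ.≟ k
  ... | yes refl = ℕₚ.<-≤-trans (g x p) (ℕₚ.m≤n⊔m N l)
  ... | no i≢k   =
    ℕₚ.<-≤-trans (h i (ℕₚ.≤∧≢⇒< (ℕₚ.≤-pred i<1+k) i≢k) x p) (ℕₚ.m≤m⊔n N l)

module _ {Φ : Theory L} where

  ∀-elim : ∀ x {φ} → Φ ⊢ all x φ ⟶ φ
  ∀-elim x {φ} = subst (λ ψ → Φ ⊢ all x φ ⟶ ψ) ([]-id φ)
    (∀1 x φ (var x) (id-substitutable φ))

  all<-elim : ∀ k {φ} → Φ ⊢ all< k φ → Φ ⊢ φ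
  all<-elim zero    d = d
  all<-elim (suc k) d = mp (all<-elim k d) (∀-elim k)

  module _ {φ : Formula L} (p : QuantifierFree φ) where

    [≔]-step : ∀ {σ τ} x u → (∀ y → y freeIn φ → σ y [ x ≔ u ]ᵗ ≡ τ y) →
               Φ ⊢ φ ⟪ σ ⟫ → Φ ⊢ φ ⟪ τ ⟫
    [≔]-step {σ} {τ} x u h d =
      subst (Φ ⊢_) (trans (⟪⟫-[] p) (⟪⟫-cong p h))
        (mp (gen x d) (∀1 x (φ ⟪ σ ⟫) u (QF-substitutable (QF-⟪⟫ p))))
      where
      QF-⟪⟫ : ∀ {ψ σ} → QuantifierFree ψ → QuantifierFree (ψ ⟪ σ ⟫)
      QF-⟪⟫ rel     = rel
      QF-⟪⟫ const   = const
      QF-⟪⟫ (p ⟶ q) = QF-⟪⟫ p ⟶ QF-⟪⟫ q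

    -- The variables below k are first renamed apart from those of the terms
    -- σ i, and then replaced one after the other.

    ⟪⟫-admissible : ∀ σ → Φ ⊢ φ → Φ ⊢ φ ⟪ σ ⟫
    ⟪⟫-admissible σ d =
      subst (Φ ⊢_)
        (⟪⟫-cong p λ x f → if-yes (x ℕₚ.<? k) (x<k x f))
        (replace k ℕₚ.≤-refl)
      where
      k = proj₁ (bound p)
      x<k = proj₂ (bound p)
      N = proj₁ (bound-σ σ k)
      k≤N = proj₁ (proj₂ (bound-σ σ k))
      σ<N = proj₂ (proj₂ (bound-σ σ k))

      τ ρ : ℕ → ℕ → Term L
      τ j i = if does (i ℕₚ.<? j) then var (N ℕ.+ i) else var i
      ρ j i = if does (i ℕₚ.<? j) then σ i else var (N ℕ.+ i)

      fresh-var : ∀ {x u y} → x ≢ y → var {L} y [ x ≔ u ]ᵗ ≡ var y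
      fresh-var {x} {u} {y} x≢y = []-freshᵗ {x = x} {u = u} (var y) λ { var → x≢y refl }

      τ-step : ∀ j → j ℕ.< k → ∀ i → τ j i [ j ≔ var (N ℕ.+ j) ]ᵗ ≡ τ (suc j) i
      τ-step j j<k i with ℕₚ.<-cmp i j
      ... | tri< i<j _ _
        rewrite if-yes {a = var {L} (N ℕ.+ i)} {b = var i} (i ℕₚ.<? j) i<j
              | if-yes {a = var {L} (N ℕ.+ i)} {b = var i} (i ℕₚ.<? suc j) (ℕₚ.m<n⇒m<1+n i<j)
        = fresh-var (ℕₚ.<⇒≢ (ℕₚ.<-≤-trans j<k (ℕₚ.≤-trans k≤N (ℕₚ.m≤m+n N i))))
      ... | tri≈ i≮i refl _
        rewrite if-no {a = var {L} (N ℕ.+ i)} {b = var i} (i ℕₚ.<? i) i≮i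
              | if-yes {a = var {L} (N ℕ.+ i)} {b = var i} (i ℕₚ.<? suc i) ℕₚ.≤-refl
        = if-yes (i ℕₚ.≟ i) refl
      ... | tri> i≮j i≢j j<i
        rewrite if-no {a = var {L} (N ℕ.+ i)} {b = var i} (i ℕₚ.<? j) i≮j
              | if-no {a = var {L} (N ℕ.+ i)} {b = var i} (i ℕₚ.<? suc j) (ℕₚ.≤⇒≯ j<i)
        = fresh-var (i≢j ∘ sym)

      ρ-step : ∀ j → ∀ i → i ℕ.< k → ρ j i [ N ℕ.+ j ≔ σ j ]ᵗ ≡ ρ (suc j) i
      ρ-step j i i<k with ℕₚ.<-cmp i j
      ... | tri< i<j _ _
        rewrite if-yes {a = σ i} {b = var (N ℕ.+ i)} (i ℕₚ.<? j) i<j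
              | if-yes {a = σ i} {b = var (N ℕ.+ i)} (i ℕₚ.<? suc j) (ℕₚ.m<n⇒m<1+n i<j)
        = []-freshᵗ (σ i) λ o → ℕₚ.<⇒≱ (σ<N i i<k _ o) (ℕₚ.m≤m+n N j)
      ... | tri≈ i≮i refl _
        rewrite if-no {a = σ i} {b = var (N ℕ.+ i)} (i ℕₚ.<? i) i≮i
              | if-yes {a = σ i} {b = var (N ℕ.+ i)} (i ℕₚ.<? suc i) ℕₚ.≤-refl
        = if-yes (N ℕ.+ i ℕₚ.≟ N ℕ.+ i) refl
      ... | tri> i≮j i≢j j<i
        rewrite if-no {a = σ i} {b = var (N ℕ.+ i)} (i ℕₚ.<? j) i≮j
              | if-no {a = σ i} {b = var (N ℕ.+ i)} (i ℕₚ.<? suc j) (ℕₚ.≤⇒≯ j<i)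
        = fresh-var (i≢j ∘ sym ∘ ℕₚ.+-cancelˡ-≡ N _ _)

      rename : ∀ j → j ℕ.≤ k → Φ ⊢ φ ⟪ τ j ⟫
      rename zero    _   = subst (Φ ⊢_) (sym (⟪var⟫ p)) d
      rename (suc j) j<k =
        [≔]-step j (var (N ℕ.+ j)) (λ i _ → τ-step j j<k i) (rename j (ℕₚ.<⇒≤ j<k))

      replace : ∀ j → j ℕ.≤ k → Φ ⊢ φ ⟪ ρ j ⟫
      replace zero    _   =
        subst (Φ ⊢_) (⟪⟫-cong p λ x f → if-yes (x ℕₚ.<? k) (x<k x f)) (rename k ℕₚ.≤-refl)
      replace (suc j) j<k =
        [≔]-step (N ℕ.+ j) (σ j) (λ i f → ρ-step j i (x<k i f)) (replace j (ℕₚ.<⇒≤ j<k))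

------------------------------------------------------------------------
-- Derivations in Łukasiewicz logic

module _ {Φ : Theory L} where

  private
    variable
      φ ψ ξ χ : Formula L

  ⊢-trans : Φ ⊢ φ ⟶ ψ → Φ ⊢ ψ ⟶ ξ → Φ ⊢ φ ⟶ ξ
  ⊢-trans d e = mp e (mp d (Ł2 _ _ _))

  ⊢-assert : Φ ⊢ φ ⟶ ((φ ⟶ ψ) ⟶ ψ)
  ⊢-assert {φ} {ψ} = ⊢-trans (Ł1 φ (ψ ⟶ φ)) (Ł4 ψ φ)

  ⊢-swap : Φ ⊢ (φ ⟶ (ψ ⟶ ξ)) ⟶ (ψ ⟶ (φ ⟶ ξ))
  ⊢-swap = ⊢-trans (Ł2 _ _ _) (mp ⊢-assert (Ł2 _ _ _))

  ⊢-refl : Φ ⊢ φ ⟶ φ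
  ⊢-refl {φ} = mp (Ł1 φ φ) (mp (Ł1 φ (φ ⟶ (φ ⟶ φ))) ⊢-swap)

  ⊢-efq : Φ ⊢ ⊥̇ ⟶ φ
  ⊢-efq = mp (mp ⊢-refl (Ł1 _ _)) (Ł3 _ _)

  ⊢-dne : Φ ⊢ ¬̇ ¬̇ φ ⟶ φ
  ⊢-dne = mp ⊢-efq (mp (Ł4 _ _) ⊢-swap)

  ⊢-contra : Φ ⊢ (φ ⟶ ψ) ⟶ (¬̇ ψ ⟶ ¬̇ φ)
  ⊢-contra = Ł2 _ _ _

  ⊢-pair : Φ ⊢ φ ⟶ (ψ ⟶ φ & ψ)
  ⊢-pair = ⊢-trans ⊢-assert ⊢-swap

  ⊢-uncurry : Φ ⊢ φ ⟶ (ψ ⟶ ξ) → Φ ⊢ φ & ψ ⟶ ξ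
  ⊢-uncurry d =
    ⊢-trans (mp (mp (⊢-trans d ⊢-contra) ⊢-swap) ⊢-contra) ⊢-dne

  ⊢-curry : Φ ⊢ φ & ψ ⟶ ξ → Φ ⊢ φ ⟶ (ψ ⟶ ξ)
  ⊢-curry d = ⊢-trans ⊢-pair (mp d (mp (Ł2 _ _ _) ⊢-swap))

  ⊢-&₁ : Φ ⊢ φ & ψ ⟶ φ
  ⊢-&₁ = ⊢-uncurry (Ł1 _ _)

  ⊢-&₂ : Φ ⊢ φ & ψ ⟶ ψ
  ⊢-&₂ = ⊢-uncurry (mp ⊢-refl (Ł1 _ _))

  ⊢-&-mono : Φ ⊢ φ ⟶ ψ → Φ ⊢ ξ ⟶ χ → Φ ⊢ φ & ξ ⟶ ψ & χ
  ⊢-&-mono d e = ⊢-uncurry (⊢-trans (⊢-trans d ⊢-pair) (mp e (Ł2 _ _ _)))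

  ⊢-modus : Φ ⊢ φ & (φ ⟶ ψ) ⟶ ψ
  ⊢-modus = ⊢-uncurry ⊢-assert

  ⊢-⊤ : Φ ⊢ ⊤̇
  ⊢-⊤ = mp ⊢-refl (mp (const-⟶ 0₀₁ 0₀₁) ⊢-&₁)
------------------------------------------------------------------------
-- Provability degrees

open +-*-Solver using (solve; _:+_; _:-_; :-_; _:=_; con)

split-< : ∀ {q a b} → q < a + b → ∃₂ λ a′ b′ → a′ < a × b′ < b × q ≡ a′ + b′
split-< {q} {a} {b} q<a+b =
  let (m , q-b<m , m<a) = ℚₚ.<-dense q-b<a in
  m , q - m , m<a ,
  subst₂ _<_ (solve 3 (λ q b m → q :- b :+ (b :- m) := q :- m) refl q b m)
             (solve 2 (λ b m → m :+ (b :- m) := b) refl b m)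
             (ℚₚ.+-monoˡ-< (b - m) q-b<m) ,
  solve 2 (λ q m → q := m :+ (q :- m)) refl q m
  where
  q-b<a : q - b < a
  q-b<a = subst (q - b <_) (solve 2 (λ a b → a :+ b :- b := a) refl a b)
            (ℚₚ.+-monoˡ-< (- b) q<a+b)

module _ {Φ : Theory L} where

  const-mono : ∀ {r s} → value r ≤ value s → Φ ⊢ const r ⟶ const s
  const-mono {r} {s} r≤s =
    mp (subst (λ q → Φ ⊢ const q) (sym r⇒s≡1) ⊢-⊤) (mp (const-⟶ r s) ⊢-&₂)
    where
    value-injective : ∀ {r s} → value r ≡ value s → r ≡ s
    value-injective refl = refl

    1≤1-r+s : 1ℚ ≤ 1ℚ - value r + value s
    1≤1-r+s = subst (_≤ 1ℚ - value r + value s)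
      (solve 1 (λ r → con 1ℚ :- r :+ r := con 1ℚ) refl (value r))
      (ℚₚ.+-monoʳ-≤ (1ℚ - value r) r≤s)

    r⇒s≡1 : r ⇒ᵠ s ≡ 1₀₁
    r⇒s≡1 = value-injective (ℚₚ.p≤q⇒p⊓q≡p 1≤1-r+s)

  Provable≥ : ℚ → Formula L → Set
  Provable≥ q φ = ∃[ r ] (q ≤ value r × Φ ⊢ const r ⟶ φ)

  Degree≥ : ℚ → Formula L → Set
  Degree≥ q φ = Below (real ∣ φ ∣[ Φ ]) q

  private
    variable
      φ ψ ξ : Formula L
      p q : ℚ

  degree-elim : Degree≥ q φ → p < q → ¬ ¬ Provable≥ p φ
  degree-elim {p = p} d p<q k = d p p<q λ where
    (inj₁ p≤0)           → k (0₀₁ , p≤0 , ⊢-efq)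
    (inj₂ ((r , e) , b)) → k (r , b , e)

  degree-intro : (∀ p → p < q → ¬ ¬ Provable≥ p φ) → Degree≥ q φ
  degree-intro h p p<q k = h p p<q λ (r , p≤r , e) → k (inj₂ ((r , e) , p≤r))

  theorem-degree : Φ ⊢ φ → Degree≥ 1ℚ φ
  theorem-degree d = degree-intro λ p p<1 k → k (1₀₁ , ℚₚ.<⇒≤ p<1 , mp d (Ł1 _ _))

  degree-mono : Φ ⊢ φ ⟶ ψ → Degree≥ q φ → Degree≥ q ψ
  degree-mono e d = degree-intro λ p p<q k → degree-elim d p<q λ (r , p≤r , f) →
    k (r , p≤r , ⊢-trans f e)

  degree-& : Degree≥ p φ → Degree≥ q ψ → Degree≥ (p + q - 1ℚ) (φ & ψ)
  degree-& {p} {φ} {q} {ψ} d e = degree-intro λ o o<p+q-1 k →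
    let (p′ , q′ , p′<p , q′<q , o+1≡p′+q′) = split-< (o+1<p+q o o<p+q-1) in
    degree-elim d p′<p λ (r , p′≤r , f) → degree-elim e q′<q λ (s , q′≤s , g) →
    k ( r &ᵠ s
      , ℚₚ.≤-trans
          (subst (_≤ value r + value s - 1ℚ)
            (trans (cong (_- 1ℚ) (sym o+1≡p′+q′))
              (solve 1 (λ o → o :+ con 1ℚ :- con 1ℚ := o) refl o))
            (ℚₚ.+-monoˡ-≤ (- 1ℚ) (ℚₚ.+-mono-≤ p′≤r q′≤s)))
          (ℚₚ.p≤q⊔p 0ℚ (value r + value s - 1ℚ))
      , ⊢-trans (mp (const-& r s) ⊢-&₂) (⊢-&-mono f g) )
    where
    o+1<p+q : ∀ o → o < p + q - 1ℚ → o + 1ℚ < p + q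
    o+1<p+q o o<p+q-1 = subst (o + 1ℚ <_)
      (solve 2 (λ p q → p :+ q :- con 1ℚ :+ con 1ℚ := p :+ q) refl p q)
      (ℚₚ.+-monoˡ-< 1ℚ o<p+q-1)

  degree-modus : Degree≥ q φ → Degree≥ 1ℚ (φ ⟶ ψ) → Degree≥ q ψ
  degree-modus {q} {ψ = ψ} d e =
    subst (λ q → Degree≥ q ψ) (solve 1 (λ q → q :+ con 1ℚ :- con 1ℚ := q) refl q)
      (degree-mono ⊢-modus (degree-& d e))

  degree-foldl : ∀ {φ φs} → Degree≥ 1ℚ φ → All (Degree≥ 1ℚ) φs → Degree≥ 1ℚ (foldl _&_ φ φs)
  degree-foldl d []       = d
  degree-foldl d (e ∷ es) = degree-foldl (degree-& d e) es

  degree-⊸ : ∀ {φs} → All (Degree≥ 1ℚ) φs → Φ ⊢ φs ⊸ ψ → Degree≥ 1ℚ ψ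
  degree-⊸ []       f = theorem-degree f
  degree-⊸ (d ∷ ds) f = degree-mono f (degree-foldl d ds)

  ≈𝟏⇒degree : ∣ φ ∣[ Φ ] ≈ᴵ 𝟏 → Degree≥ 1ℚ φ
  ≈𝟏⇒degree (_ , h) = h 1ℚ ℚₚ.≤-refl

  degree⇒≈𝟏 : Degree≥ 1ℚ φ → ∣ φ ∣[ Φ ] ≈ᴵ 𝟏
  degree⇒≈𝟏 {φ} d = 𝕀.≤1 ∣ φ ∣[ Φ ] , λ q q≤1 → down (real ∣ φ ∣[ Φ ]) q≤1 d

------------------------------------------------------------------------
-- The term structure

_∼[_]_ : Term L → Theory L → Term L → Set
t ∼[ Φ ] u = ∣ t ≐ u ∣[ Φ ] ≈ᴵ 𝟏

assign : Vec (Term L) n → (ℕ → Term L) → ℕ → Term L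
assign []       σ x       = σ x
assign (t ∷ ts) σ zero    = t
assign (t ∷ ts) σ (suc x) = assign ts σ x

module _ {Φ : Theory L} where

  ∼-refl : ∀ {t} → t ∼[ Φ ] t
  ∼-refl {t} = degree⇒≈𝟏 {Φ = Φ} (theorem-degree
    (⟪⟫-admissible rel (assign (t ∷ []) var) (all<-elim 1 S1)))

  ∼-sym : ∀ {t u} → t ∼[ Φ ] u → u ∼[ Φ ] t
  ∼-sym {t} {u} d = degree⇒≈𝟏 {Φ = Φ} (degree-mono
    (⟪⟫-admissible (rel ⟶ rel) (assign (t ∷ u ∷ []) var) (all<-elim 2 S2))
    (≈𝟏⇒degree {Φ = Φ} d))

  ∼-trans : ∀ {t u w} → t ∼[ Φ ] u → u ∼[ Φ ] w → t ∼[ Φ ] w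
  ∼-trans {t} {u} {w} d e = degree⇒≈𝟏 {Φ = Φ} (degree-mono
    (⟪⟫-admissible (((rel ⟶ (rel ⟶ const)) ⟶ const) ⟶ rel)
      (assign (t ∷ u ∷ w ∷ []) var) (all<-elim 3 S3))
    (degree-& (≈𝟏⇒degree {Φ = Φ} d) (≈𝟏⇒degree {Φ = Φ} e)))

vars-⟪⟫ : ∀ k n (σ : ℕ → Term L) → vars k n ⟪ σ ⟫ᵗˢ ≡ tabulate λ i → σ (k ℕ.+ toℕ i)
vars-⟪⟫ {L} k n σ = go n λ i → k ℕ.+ toℕ i
  where
  go : ∀ n (f : Fin n → ℕ) → tabulate (λ i → var {L} (f i)) ⟪ σ ⟫ᵗˢ ≡ tabulate (λ i → σ (f i))
  go zero    f = refl
  go (suc n) f = cong (_ ∷_) (go n (f ∘ Fin.suc))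

assign-< : ∀ (ts : Vec (Term L) n) σ → vars 0 n ⟪ assign ts σ ⟫ᵗˢ ≡ ts
assign-< {L} ts σ = trans (vars-⟪⟫ 0 _ _) (go ts)
  where
  go : ∀ {n} (ts : Vec (Term L) n) → tabulate (λ i → assign ts σ (toℕ i)) ≡ ts
  go []       = refl
  go (t ∷ ts) = cong (t ∷_) (go ts)

assign-≥ : ∀ (ts us : Vec (Term L) n) → vars n n ⟪ assign ts (assign us var) ⟫ᵗˢ ≡ us
assign-≥ {L} {n} ts us = trans (vars-⟪⟫ n n _)
  (trans (tabulate-cong λ i → go ts _ (toℕ i)) (trans (sym (vars-⟪⟫ 0 n _)) (assign-< us var)))
  where
  go : ∀ {n} (ts : Vec (Term L) n) σ x → assign ts σ (n ℕ.+ x) ≡ σ x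
  go []       σ x = refl
  go (t ∷ ts) σ x = go ts σ x

foldl-⟪⟫ : ∀ (ts us : Vec (Term L) n) (φ : Formula L) σ →
           foldl _&_ φ (ts ≐* us) ⟪ σ ⟫ ≡ foldl _&_ (φ ⟪ σ ⟫) (ts ⟪ σ ⟫ᵗˢ ≐* us ⟪ σ ⟫ᵗˢ)
foldl-⟪⟫ []       []       φ σ = refl
foldl-⟪⟫ (t ∷ ts) (u ∷ us) φ σ = foldl-⟪⟫ ts us (φ & (t ≐ u)) σ

⊸-⟪⟫ : ∀ (ts us : Vec (Term L) n) (ψ : Formula L) σ →
       (ts ≐* us ⊸ ψ) ⟪ σ ⟫ ≡ (ts ⟪ σ ⟫ᵗˢ ≐* us ⟪ σ ⟫ᵗˢ ⊸ ψ ⟪ σ ⟫)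
⊸-⟪⟫ []       []       ψ σ = refl
⊸-⟪⟫ (t ∷ ts) (u ∷ us) ψ σ = cong (_⟶ ψ ⟪ σ ⟫) (foldl-⟪⟫ ts us (t ≐ u) σ)

⊸-QF : ∀ (ts us : Vec (Term L) n) {ψ} → QuantifierFree ψ → QuantifierFree (ts ≐* us ⊸ ψ)
⊸-QF []       []       p = p
⊸-QF (t ∷ ts) (u ∷ us) p = go rel ts us ⟶ p
  where
  go : ∀ {n φ} → QuantifierFree φ → (ts us : Vec (Term _) n) →
       QuantifierFree (foldl _&_ φ (ts ≐* us))
  go p []       []       = p
  go p (t ∷ ts) (u ∷ us) = go ((p ⟶ (rel ⟶ const)) ⟶ const) ts us

module _ {Φ : Theory L} where

  ≐*-degree : {ts us : Vec (Term L) n} → Pointwise _∼[ Φ ]_ ts us →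
              All (Degree≥ {Φ = Φ} 1ℚ) (ts ≐* us)
  ≐*-degree []       = []
  ≐*-degree (d ∷ ds) = ≈𝟏⇒degree {Φ = Φ} d ∷ ≐*-degree ds

  congruence : (ψ : Vec (Term L) n → Vec (Term L) n → Formula L) →
               (∀ {ts us} → QuantifierFree (ψ ts us)) →
               (∀ ts us σ → ψ ts us ⟪ σ ⟫ ≡ ψ (ts ⟪ σ ⟫ᵗˢ) (us ⟪ σ ⟫ᵗˢ)) →
               Φ ⊢ all< (n ℕ.+ n) (vars 0 n ≐* vars n n ⊸ ψ (vars 0 n) (vars n n)) →
               ∀ {ts us} → Pointwise _∼[ Φ ]_ ts us → Degree≥ {Φ = Φ} 1ℚ (ψ ts us)
  congruence {n} ψ p ψ-⟪⟫ d {ts} {us} ts∼us =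
    degree-⊸ (≐*-degree ts∼us) (subst (Φ ⊢_) eq
      (⟪⟫-admissible (⊸-QF (vars 0 n) (vars n n) p) σ (all<-elim (n ℕ.+ n) d)))
    where
    σ = assign ts (assign us var)
    eq : (vars 0 n ≐* vars n n ⊸ ψ (vars 0 n) (vars n n)) ⟪ σ ⟫ ≡ (ts ≐* us ⊸ ψ ts us)
    eq = trans (⊸-⟪⟫ (vars 0 n) (vars n n) _ σ)
       (trans (cong (vars 0 n ⟪ σ ⟫ᵗˢ ≐* vars n n ⟪ σ ⟫ᵗˢ ⊸_) (ψ-⟪⟫ _ _ σ))
         (cong₂ (λ ts us → ts ≐* us ⊸ ψ ts us) (assign-< ts _) (assign-≥ ts us)))

  fun-cong : (F : Func L n) → ∀ {ts us} → Pointwise _∼[ Φ ]_ ts us → fun F ts ∼[ Φ ] fun F us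
  fun-cong F ts∼us = degree⇒≈𝟏 {Φ = Φ}
    (congruence (λ ts us → fun F ts ≐ fun F us) rel (λ _ _ _ → refl) (C1 F) ts∼us)

  rel-cong : (P : Pred L n) → ∀ {ts us} → Pointwise _∼[ Φ ]_ ts us →
             ∣ rel P ts ∣[ Φ ] ≈ᴵ ∣ rel P us ∣[ Φ ]
  rel-cong P ts∼us =
      (λ q d → degree-modus {Φ = Φ} d (degree-mono ⊢-&₁ P↔P))
    , (λ q d → degree-modus {Φ = Φ} d (degree-mono ⊢-&₂ P↔P))
    where
    P↔P = congruence (λ ts us → rel P ts ⟷ rel P us)
      (((rel ⟶ rel) ⟶ ((rel ⟶ rel) ⟶ const)) ⟶ const) (λ _ _ _ → refl) (C2 P) ts∼us

TermStructure : Theory L → Structure L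
TermStructure {L} Φ = record
  { domain   = record
    { Carrier       = Term L
    ; _≈_           = _∼[ Φ ]_
    ; isEquivalence = record
      { refl  = ∼-refl {Φ = Φ}
      ; sym   = ∼-sym {Φ = Φ}
      ; trans = ∼-trans {Φ = Φ}
      }
    }
  ; point    = var 0
  ; ⟦_⟧ᶠ     = fun
  ; ⟦⟧ᶠ-cong = fun-cong {Φ = Φ}
  ; ⟦_⟧ᴾ     = λ P ts → ∣ rel P ts ∣[ Φ ]
  ; ⟦⟧ᴾ-cong = rel-cong {Φ = Φ}
  }

------------------------------------------------------------------------
-- Horn clauses

-- The truth constants 0 and 1, which evaluated formulas may contain, count
-- as atomic formulas.

data Atomic {L : Language} : Formula L → Set where
  rel : (P : Pred L n) (ts : Vec (Term L) n) → Atomic (rel P ts)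
  bot : Atomic ⊥̇
  top : Atomic ⊤̇

data EvaluatedAtomic {L : Language} : Formula L → Set where
  ⟨_,_⟩ : ∀ {α} → Atomic α → ∀ r → EvaluatedAtomic (const r ⟶ α)

-- Non-empty conjunctions of formulas satisfying S, bracketed in any way.

data Conjunction {L : Language} (S : Formula L → Set) : Formula L → Set where
  [_] : ∀ {φ} → S φ → Conjunction S φ
  _∧_ : ∀ {φ ψ} → Conjunction S φ → Conjunction S ψ → Conjunction S (φ & ψ)

data BasicHorn {L : Language} : Formula L → Set where
  fact : ∀ {β} → EvaluatedAtomic β → BasicHorn β
  rule : ∀ {φ β} → Conjunction EvaluatedAtomic φ → EvaluatedAtomic β → BasicHorn (φ ⟶ β)

QuantifierFreeHorn : Formula L → Set
QuantifierFreeHorn = Conjunction BasicHorn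

data HornClause {L : Language} : Formula L → Set where
  qf  : ∀ {φ} → QuantifierFreeHorn φ → HornClause φ
  all : ∀ x {φ} → HornClause φ → HornClause (all x φ)

{-# OPTIONS --safe #-}
module Submission where

open import Defs

-- An evaluation v in the term structure is a substitution, and for an
-- evaluated atomic formula φ the value of φ under v is the provability degree
-- of φ ⟪ v ⟫; for the truth constant 0 this is where consistency is needed.
-- Degrees are only supermultiplicative, | φ | & | ψ | ≤ | φ & ψ |, so a
-- conjunction has value at most its degree: the right direction in the
-- antecedent of a Horn formula.  A conjunction of degree 1, on the other hand,
-- has conjuncts of degree 1.  Quantifiers are stripped since the degree does
-- not decrease from (∀ x) φ to any instance of φ.

open import Data.Integer.Base as ℤ using (+_)
import Data.Integer.Properties as ℤₚ
import Data.Integer.Solver as ℤ-Solver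
open import Data.Nat.Base using (ℕ; zero; suc)
open import Data.Product using (∃-syntax; _×_; _,_; proj₁; proj₂)
open import Data.Rational
  using (ℚ; 0ℚ; 1ℚ; _+_; _-_; -_; _≤_; _<_; mkℚ; toℚᵘ; +-0-rawMonoid)
import Data.Rational.Properties as ℚₚ
open import Data.Rational.Solver using (module +-*-Solver)
open import Data.Rational.Unnormalised.Base as ℚᵘ using (mkℚᵘ; *≡*)
import Data.Rational.Unnormalised.Properties as ℚᵘₚ
open import Data.Vec.Base using (Vec; []; _∷_)
open import Relation.Binary.PropositionalEquality
open import Relation.Nullary using (¬_)

open import Algebra.Definitions.RawMonoid +-0-rawMonoid
  using () renaming (_×_ to _·_)

open +-*-Solver using (solve; _:+_; _:-_; _:=_; con)

-- Archimedean property of the rationals.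

private
  variable
    p q ε : ℚ

toℚᵘ-· : ∀ n p → toℚᵘ (n · p) ℚᵘ.≃ mkℚᵘ (+ n ℤ.* ℚ.numerator p) (ℚ.denominator-1 p)
toℚᵘ-· zero    p = *≡* refl
toℚᵘ-· (suc n) p@(mkℚ a d _) = begin
  toℚᵘ (p + n · p)                  ≈⟨ ℚₚ.toℚᵘ-homo-+ p (n · p) ⟩
  toℚᵘ p ℚᵘ.+ toℚᵘ (n · p)          ≈⟨ ℚᵘₚ.+-congʳ (toℚᵘ p) (toℚᵘ-· n p) ⟩
  mkℚᵘ a d ℚᵘ.+ mkℚᵘ (+ n ℤ.* a) d  ≈⟨ *≡* (lemma a (+ n) (+ suc d)) ⟩
  mkℚᵘ (+ suc n ℤ.* a) d            ∎
  where
  open ℚᵘₚ.≃-Reasoning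
  lemma : ∀ a n d → (a ℤ.* d ℤ.+ n ℤ.* a ℤ.* d) ℤ.* d ≡ (+ 1 ℤ.+ n) ℤ.* a ℤ.* (d ℤ.* d)
  lemma = ℤ-Solver.+-*-Solver.solve 3
    (λ a n d → (a ⊗ d ⊕ n ⊗ a ⊗ d) ⊗ d ⊜ (κ (+ 1) ⊕ n) ⊗ a ⊗ (d ⊗ d)) refl
    where open ℤ-Solver.+-*-Solver renaming (_:*_ to _⊗_; _:+_ to _⊕_; _:=_ to _⊜_; con to κ)

-- The denominator of `p` serves as the multiplier: it turns `p` into its numerator, a positive
-- integer and hence at least 1.
archimedean : 0ℚ < p → ∃[ n ] 1ℚ ≤ n · p
archimedean {p@(mkℚ a d _)} 0<p = suc d , ℚₚ.toℚᵘ-cancel-≤ (begin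
  toℚᵘ 1ℚ                     ≤⟨ ℚᵘ.*≤* ineq ⟩
  mkℚᵘ (+ suc d ℤ.* a) d      ≃⟨ toℚᵘ-· (suc d) p ⟨
  toℚᵘ (suc d · p)            ∎)
  where
  open ℚᵘₚ.≤-Reasoning
  ineq : + 1 ℤ.* + suc d ℤ.≤ (+ suc d ℤ.* a) ℤ.* + 1
  ineq = subst₂ ℤ._≤_ (ℤₚ.*-comm (+ suc d) (+ 1)) (sym (ℤₚ.*-identityʳ _))
    (ℤₚ.*-monoˡ-≤-nonNeg (+ suc d)
      (ℤₚ.i<j⇒suc[i]≤j (subst₂ ℤ._<_ refl (ℤₚ.*-identityʳ a) (ℚₚ.drop-*<* 0<p))))

archimedean-induction : (P : ℚ → Set) → 0ℚ < ε → P 0ℚ → (∀ q → 0ℚ ≤ q → P q → P (q + ε)) →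
                        ∃[ q ] (1ℚ ≤ q × P q)
archimedean-induction {ε} P 0<ε base step =
  let (n , 1≤nε) = archimedean 0<ε in n · ε , 1≤nε , proj₂ (go n)
  where
  go : ∀ n → 0ℚ ≤ n · ε × P (n · ε)
  go zero    = ℚₚ.≤-refl , base
  go (suc n) = let (0≤nε , P-nε) = go n in
      ℚₚ.+-mono-≤ (ℚₚ.<⇒≤ 0<ε) 0≤nε
    , subst P (ℚₚ.+-comm (n · ε) ε) (step _ 0≤nε P-nε)

≤⇒≯ : p ≤ q → ¬ q < p
≤⇒≯ p≤q q<p = ℚₚ.<-irrefl refl (ℚₚ.<-≤-trans q<p p≤q)

x+y-y≡x : ∀ x y → x + y - y ≡ x
x+y-y≡x = solve 2 (λ x y → x :+ y :- y := x) refl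

-- Łukasiewicz operations on cuts.

module _ (a : 𝕀) where

  -- If no such `s` existed, the cut would be closed under adding `ε`, and `archimedean-induction`
  -- would carry it past 1.
  approximable : 0ℚ < ε →
                 ¬ ¬ (∃[ s ] (Below (real a) s × (∀ t → Below (real a) t → t ≤ s + ε)))
  approximable {ε} 0<ε k =
    let (q , 1≤q , aq) = archimedean-induction (Below (real a)) 0<ε
                           (𝕀.0≤ a 0ℚ ℚₚ.≤-refl) step
        0≤q = ℚₚ.≤-trans (ℚₚ.nonNegative⁻¹ 1ℚ) 1≤q
    in ≤⇒≯ (𝕀.≤1 a (q + ε) (step q 0≤q aq)) (ℚₚ.+-mono-≤-< 1≤q 0<ε)
    where
    step : ∀ q → 0ℚ ≤ q → Below (real a) q → Below (real a) (q + ε)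
    step q _ aq = stable (real a) λ ¬a →
      k (q , aq , λ t at → ℚₚ.≮⇒≥ λ q+ε<t → ¬a (down (real a) (ℚₚ.<⇒≤ q+ε<t) at))

module _ (a b : 𝕀) where

  -- Residuation: together with `⇒ᴵ-elim` this replaces the sum of cuts in `_⇒ᴵ_` by a condition on
  -- rationals.
  ⇒ᴵ-intro : q ≤ 1ℚ → (∀ p → Below (real a) p → Below (real b) (p + q - 1ℚ)) →
             Below (real (a ⇒ᴵ b)) q
  ⇒ᴵ-intro {q} q≤1 h = q≤1 , λ o o<q k →
    let 0<q-o = subst (_< q - o) (ℚₚ.+-inverseʳ o) (ℚₚ.+-monoˡ-< (- o) o<q) in
    approximable a 0<q-o λ (s , as , s-max) →
    -- The summands add up to exactly `o`: the first is below `1 - a` because `s + (q - o)` bounds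
    -- `a`, the second is below `b` by `h`.
    k ( 1ℚ - (s + (q - o)) , s + q - 1ℚ
      , (λ p p< k → k (1ℚ , - (s + (q - o)) , ℚₚ.≤-refl
                      , (λ t at → ℚₚ.neg-antimono-≤ (s-max t at)) , ℚₚ.<⇒≤ p<))
      , h s as
      , ℚₚ.≤-reflexive (solve 3 (λ o q s →
          o := con 1ℚ :- (s :+ (q :- o)) :+ (s :+ q :- con 1ℚ)) refl o q s) )

  ⇒ᴵ-elim : Below (real (a ⇒ᴵ b)) q → Below (real a) p → Below (real b) (p + q - 1ℚ)
  ⇒ᴵ-elim {q} {p} (_ , h) ap = closed (real b) λ o o<p+q-1 → stable (real b) λ k →
    -- Since `c` is at most `1 - p`, cancelling the shift `1 - p` leaves `o ≤ d`.
    h (o + (1ℚ - p)) (o+1-p<q o o<p+q-1) λ (c , d , 1-a≥c , bd , o+1-p≤c+d) →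
    k (down (real b) (o≤d o c d (c≤1-p c 1-a≥c) o+1-p≤c+d) bd)
    where
    o+1-p<q : ∀ o → o < p + q - 1ℚ → o + (1ℚ - p) < q
    o+1-p<q o o< = subst (o + (1ℚ - p) <_)
      (solve 2 (λ p q → p :+ q :- con 1ℚ :+ (con 1ℚ :- p) := q) refl p q)
      (ℚₚ.+-monoˡ-< (1ℚ - p) o<)

    c≤1-p : ∀ c → Below (fromℚ 1ℚ -ʳ real a) c → c ≤ 1ℚ - p
    c≤1-p c 1-a≥c = ≤-approx λ c′ c′<c → ≤-stable λ k →
      1-a≥c c′ c′<c λ (e , f , e≤1 , f≤-a , c′≤e+f) →
      k (ℚₚ.≤-trans c′≤e+f (ℚₚ.+-mono-≤ e≤1 (f≤-a p ap)))

    o≤d : ∀ o c d → c ≤ 1ℚ - p → o + (1ℚ - p) ≤ c + d → o ≤ d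
    o≤d o c d c≤ o≤ = subst₂ _≤_ (x+y-y≡x o (1ℚ - p))
      (solve 2 (λ d e → e :+ d :- e := d) refl d (1ℚ - p))
      (ℚₚ.+-monoˡ-≤ (- (1ℚ - p)) (ℚₚ.≤-trans o≤ (ℚₚ.+-monoˡ-≤ d c≤)))

⇒ᴵ-monoʳ : ∀ c a b → a ≤ᴵ b → c ⇒ᴵ a ≤ᴵ c ⇒ᴵ b
⇒ᴵ-monoʳ c a b a≤b q d = ⇒ᴵ-intro c b (proj₁ d) λ p cp → a≤b _ (⇒ᴵ-elim c a d cp)

𝟎 : 𝕀
𝟎 = fromℚ₀₁ 0₀₁

infixr 7 _&ᴵ_

-- Spelled out like the formula `φ & ψ`, so that the value of a conjunction is definitionally `_&ᴵ_`
-- of the values.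
_&ᴵ_ : 𝕀 → 𝕀 → 𝕀
a &ᴵ b = (a ⇒ᴵ (b ⇒ᴵ 𝟎)) ⇒ᴵ 𝟎

p+q-1≤1 : p ≤ 1ℚ → q ≤ 1ℚ → p + q - 1ℚ ≤ 1ℚ
p+q-1≤1 p≤1 q≤1 = ℚₚ.+-monoˡ-≤ (- 1ℚ) (ℚₚ.+-mono-≤ p≤1 q≤1)

module _ (a b : 𝕀) where

  &ᴵ-intro : Below (real a) p → Below (real b) q → Below (real (a &ᴵ b)) (p + q - 1ℚ)
  &ᴵ-intro {p} {q} ap bq = ⇒ᴵ-intro (a ⇒ᴵ (b ⇒ᴵ 𝟎)) 𝟎
    (p+q-1≤1 (𝕀.≤1 a p ap) (𝕀.≤1 b q bq)) λ s f →
    subst (_≤ 0ℚ)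
      (solve 3 (λ p q s → q :+ (p :+ s :- con 1ℚ) :- con 1ℚ
                       := s :+ (p :+ q :- con 1ℚ) :- con 1ℚ) refl p q s)
      (⇒ᴵ-elim b 𝟎 (⇒ᴵ-elim a (b ⇒ᴵ 𝟎) f ap) bq)

  -- If some `o < r` were not below `c`, every `p + q - 1` would be at most `o`. Then `1 - o` is
  -- below `a ⇒ᴵ (b ⇒ᴵ 𝟎)`, whose negation contains `r`, and this forces `r ≤ o`.
  &ᴵ-least : ∀ c → (∀ p q → Below (real a) p → Below (real b) q → Below (real c) (p + q - 1ℚ)) →
             a &ᴵ b ≤ᴵ c
  &ᴵ-least c h r d = closed (real c) λ o o<r → stable (real c) λ ¬co →
    ≤⇒≯ (r≤o o (⇒ᴵ-elim (a ⇒ᴵ (b ⇒ᴵ 𝟎)) 𝟎 d (1-o-below o ¬co))) o<r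
    where
    r≤o : ∀ o → (1ℚ - o) + r - 1ℚ ≤ 0ℚ → r ≤ o
    r≤o o le = subst₂ _≤_
      (solve 2 (λ o r → con 1ℚ :- o :+ r :- con 1ℚ :+ o := r) refl o r)
      (ℚₚ.+-identityˡ o) (ℚₚ.+-monoˡ-≤ o le)

    1-o-below : ∀ o → ¬ Below (real c) o → Below (real (a ⇒ᴵ (b ⇒ᴵ 𝟎))) (1ℚ - o)
    1-o-below o ¬co = ⇒ᴵ-intro a (b ⇒ᴵ 𝟎) 1-o≤1 λ p ap →
      ⇒ᴵ-intro b 𝟎 (p+q-1≤1 (𝕀.≤1 a p ap) 1-o≤1) λ q bq →
      subst₂ _≤_
        (solve 3 (λ o p q → p :+ q :- con 1ℚ :- o
                         := q :+ (p :+ (con 1ℚ :- o) :- con 1ℚ) :- con 1ℚ) refl o p q)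
        (ℚₚ.+-inverseʳ o)
        (ℚₚ.+-monoˡ-≤ (- o) (ℚₚ.≮⇒≥ λ o<p+q-1 →
          ¬co (down (real c) (ℚₚ.<⇒≤ o<p+q-1) (h p q ap bq))))
      where
      1-o≤1 : 1ℚ - o ≤ 1ℚ
      1-o≤1 = ℚₚ.+-monoʳ-≤ 1ℚ (ℚₚ.neg-antimono-≤
        (ℚₚ.<⇒≤ (ℚₚ.≰⇒> λ o≤0 → ¬co (𝕀.0≤ c o o≤0))))

-- Provability degrees of implications and truth constants.

module _ {Φ : Theory L} where

  private
    variable
      φ ψ : Formula L

  degree-⟪⟫ : QuantifierFree φ → ∀ σ → Degree≥ {Φ = Φ} q φ → Degree≥ {Φ = Φ} q (φ ⟪ σ ⟫)
  degree-⟪⟫ φ-qf σ d = degree-intro λ p p<q k → degree-elim d p<q λ (r , p≤r , e) →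
    k (r , p≤r , ⟪⟫-admissible (const ⟶ φ-qf) σ e)

  degree-const : ∀ r → fromℚ₀₁ r ≤ᴵ ∣ const r ∣[ Φ ]
  degree-const r q q≤r = degree-intro λ p p<q k → k (r , ℚₚ.<⇒≤ (ℚₚ.<-≤-trans p<q q≤r) , ⊢-refl)

  degree-⟶ : ∣ φ ⟶ ψ ∣[ Φ ] ≤ᴵ ∣ φ ∣[ Φ ] ⇒ᴵ ∣ ψ ∣[ Φ ]
  degree-⟶ {φ} {ψ} q d = ⇒ᴵ-intro ∣ φ ∣[ Φ ] ∣ ψ ∣[ Φ ] (𝕀.≤1 ∣ φ ⟶ ψ ∣[ Φ ] q d)
    λ p e → degree-mono ⊢-modus (degree-& e d)

  ⊢-const-⇒ : ∀ r {s} → Φ ⊢ const s ⟶ φ → Φ ⊢ const (r ⇒ᵠ s) ⟶ (const r ⟶ φ)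
  ⊢-const-⇒ r {s} d =
    ⊢-trans (mp (const-⟶ r s) ⊢-&₂) (mp d (mp (Ł2 _ _ _) ⊢-swap))

  -- With a truth constant as antecedent, `degree-⟶` has a converse: a proof of `const s ⟶ φ` can be
  -- residuated by `r` inside the calculus, through the bookkeeping axiom for implication.
  degree-evaluated : ∀ r → ∣ const r ⟶ φ ∣[ Φ ] ≈ᴵ fromℚ₀₁ r ⇒ᴵ ∣ φ ∣[ Φ ]
  degree-evaluated {φ} r = to , from
    where
    a = ∣ φ ∣[ Φ ]

    to : ∣ const r ⟶ φ ∣[ Φ ] ≤ᴵ fromℚ₀₁ r ⇒ᴵ a
    to q d = ⇒ᴵ-intro (fromℚ₀₁ r) a (𝕀.≤1 ∣ const r ⟶ φ ∣[ Φ ] q d) λ p p≤r →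
      ⇒ᴵ-elim ∣ const r ∣[ Φ ] a (degree-⟶ q d) (degree-const r p p≤r)

    from : fromℚ₀₁ r ⇒ᴵ a ≤ᴵ ∣ const r ⟶ φ ∣[ Φ ]
    from q d = degree-intro λ p p<q k →
      -- The degree of `φ` is at least `r + q - 1`; lowering `q` to `p` gives an actual proof with a
      -- constant `s ≥ r + p - 1`, and then `r ⇒ᵠ s` is at least `p`.
      degree-elim (⇒ᴵ-elim (fromℚ₀₁ r) a d ℚₚ.≤-refl)
        (ℚₚ.+-monoˡ-< (- 1ℚ) (ℚₚ.+-monoʳ-< (value r) p<q)) λ (s , r+p-1≤s , e) →
      k ( r ⇒ᵠ s
        , ℚₚ.⊓-glb (ℚₚ.<⇒≤ (ℚₚ.<-≤-trans p<q (proj₁ d)))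
            (subst (_≤ 1ℚ - value r + value s)
              (solve 2 (λ p r → con 1ℚ :- r :+ (r :+ p :- con 1ℚ) := p) refl p (value r))
              (ℚₚ.+-monoʳ-≤ (1ℚ - value r) r+p-1≤s))
        , ⊢-const-⇒ r e )

  -- Since r̄ → 0̄ is equivalent to the constant 1 - r, conjoining it with a
  -- provable constant lowers the latter by r, until 0 is reached.
  refutable-const : ∀ r → 0ℚ < value r → Φ ⊢ const r ⟶ ⊥̇ → Φ ⊢ ⊥̇
  refutable-const r 0<r d =
    let (q , 1≤q , P-q) = archimedean-induction P 0<r
                            (λ t t≤0 e → mp e (const-mono t≤0)) step
    in P-q 1₀₁ 1≤q ⊢-⊤
    where
    P : ℚ → Set
    P q = ∀ t → value t ≤ q → Φ ⊢ const t → Φ ⊢ ⊥̇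

    s = r ⇒ᵠ 0₀₁

    step : ∀ q → 0ℚ ≤ q → P q → P (q + value r)
    step q 0≤q P-q t t≤q+r e = P-q (t &ᵠ s) (ℚₚ.⊔-lub 0≤q t+s-1≤q)
      (mp (mp (mp d (mp (const-⟶ r 0₀₁) ⊢-&₁)) (mp e ⊢-pair)) (mp (const-& t s) ⊢-&₁))
      where
      t+s-1≤q : value t + value s - 1ℚ ≤ q
      t+s-1≤q = subst (value t + value s - 1ℚ ≤_)
        (solve 2 (λ q r → q :+ r :+ (con 1ℚ :- r :+ con 0ℚ) :- con 1ℚ := q) refl q (value r))
        (ℚₚ.+-monoˡ-≤ (- 1ℚ) (ℚₚ.+-mono-≤ t≤q+r (ℚₚ.p⊓q≤q 1ℚ (1ℚ - value r + 0ℚ))))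

  -- A positive degree would make some positive truth constant refutable, which `refutable-const`
  -- turns into an inconsistency.
  degree-⊥ : Consistent Φ → ∣ ⊥̇ ∣[ Φ ] ≤ᴵ 𝟎
  degree-⊥ cons q d = ≤-approx λ p p<q → ≤-stable λ k → degree-elim d p<q λ (r , p≤r , e) →
    cons (refutable-const r (ℚₚ.<-≤-trans (ℚₚ.≰⇒> k) p≤r) e)

Conjunction-QF : {S : Formula L → Set} → (∀ {φ} → S φ → QuantifierFree φ) →
                 ∀ {φ} → Conjunction S φ → QuantifierFree φ
Conjunction-QF S-QF [ s ]   = S-QF s
Conjunction-QF S-QF (c ∧ d) =
  (Conjunction-QF S-QF c ⟶ (Conjunction-QF S-QF d ⟶ const)) ⟶ const

EvaluatedAtomic-QF : {φ : Formula L} → EvaluatedAtomic φ → QuantifierFree φ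
EvaluatedAtomic-QF ⟨ rel P ts , r ⟩ = const ⟶ rel
EvaluatedAtomic-QF ⟨ bot , r ⟩      = const ⟶ const
EvaluatedAtomic-QF ⟨ top , r ⟩      = const ⟶ const

BasicHorn-QF : {φ : Formula L} → BasicHorn φ → QuantifierFree φ
BasicHorn-QF (fact β)   = EvaluatedAtomic-QF β
BasicHorn-QF (rule α β) = Conjunction-QF EvaluatedAtomic-QF α ⟶ EvaluatedAtomic-QF β

-- Values and degrees in the term structure.

module _ (Φ : Theory L) where

  open Semantics (TermStructure Φ)

  ⟦⟧ᵗ-⟪⟫ᵗ   : ∀ t v → ⟦ t ⟧ᵗ v ≡ t ⟪ v ⟫ᵗ
  ⟦⟧ᵗˢ-⟪⟫ᵗˢ : ∀ (ts : Vec (Term L) n) v → ⟦ ts ⟧ᵗˢ v ≡ ts ⟪ v ⟫ᵗˢ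

  ⟦⟧ᵗ-⟪⟫ᵗ (var x)    v = refl
  ⟦⟧ᵗ-⟪⟫ᵗ (fun F ts) v = cong (fun F) (⟦⟧ᵗˢ-⟪⟫ᵗˢ ts v)

  ⟦⟧ᵗˢ-⟪⟫ᵗˢ []       v = refl
  ⟦⟧ᵗˢ-⟪⟫ᵗˢ (t ∷ ts) v = cong₂ _∷_ (⟦⟧ᵗ-⟪⟫ᵗ t v) (⟦⟧ᵗˢ-⟪⟫ᵗˢ ts v)

  module _ (cons : Consistent Φ) (v : Evaluation) where

    Atomic-value : ∀ {α} → Atomic α → ⟦ α ⟧ v ≈ᴵ ∣ α ⟪ v ⟫ ∣[ Φ ]
    Atomic-value (rel P ts) = subst (λ us → ∣ rel P (⟦ ts ⟧ᵗˢ v) ∣[ Φ ] ≈ᴵ ∣ rel P us ∣[ Φ ])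
      (⟦⟧ᵗˢ-⟪⟫ᵗˢ ts v) ((λ q d → d) , (λ q d → d))
    Atomic-value bot = degree-const 0₀₁ , degree-⊥ cons
    Atomic-value top = degree-const 1₀₁ , 𝕀.≤1 ∣ ⊤̇ ∣[ Φ ]

    EvaluatedAtomic-value : ∀ {φ} → EvaluatedAtomic φ → ⟦ φ ⟧ v ≈ᴵ ∣ φ ⟪ v ⟫ ∣[ Φ ]
    EvaluatedAtomic-value (⟨_,_⟩ {α} a r) =
        (λ q d → proj₂ (degree-evaluated r) q
          (⇒ᴵ-monoʳ c (⟦ α ⟧ v) ∣α∣ (proj₁ (Atomic-value a)) q d))
      , (λ q d → ⇒ᴵ-monoʳ c ∣α∣ (⟦ α ⟧ v) (proj₂ (Atomic-value a)) q
          (proj₁ (degree-evaluated r) q d))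
      where
      c   = fromℚ₀₁ r
      ∣α∣ = ∣ α ⟪ v ⟫ ∣[ Φ ]

    Conjunction-value-≤ : ∀ {φ} → Conjunction EvaluatedAtomic φ → ⟦ φ ⟧ v ≤ᴵ ∣ φ ⟪ v ⟫ ∣[ Φ ]
    Conjunction-value-≤ [ e ] = proj₁ (EvaluatedAtomic-value e)
    Conjunction-value-≤ (_∧_ {φ} {ψ} c d) =
      &ᴵ-least (⟦ φ ⟧ v) (⟦ ψ ⟧ v) ∣ (φ & ψ) ⟪ v ⟫ ∣[ Φ ] λ p q φp ψq →
        degree-& (Conjunction-value-≤ c p φp) (Conjunction-value-≤ d q ψq)

    -- Implication is antitone in its antecedent, so the upper bound on the value of the antecedent
    -- suffices; for the consequent, value and degree agree.
    BasicHorn-value : ∀ {φ} → BasicHorn φ → ∣ φ ⟪ v ⟫ ∣[ Φ ] ≤ᴵ ⟦ φ ⟧ v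
    BasicHorn-value (fact β) = proj₂ (EvaluatedAtomic-value β)
    BasicHorn-value (rule {φ} {β} α e) q d =
      ⇒ᴵ-intro (⟦ φ ⟧ v) (⟦ β ⟧ v) (𝕀.≤1 ∣ (φ ⟶ β) ⟪ v ⟫ ∣[ Φ ] q d) λ p φp →
        proj₂ (EvaluatedAtomic-value e) _
          (⇒ᴵ-elim ∣ φ ⟪ v ⟫ ∣[ Φ ] ∣ β ⟪ v ⟫ ∣[ Φ ] (degree-⟶ q d) (Conjunction-value-≤ α p φp))

    -- Restricted to level 1, where nothing is lost: `&ᴵ-intro` yields `1 + 1 - 1`, whereas
    -- conjuncts at level `q` would only yield `q + q - 1`.
    QuantifierFreeHorn-value : ∀ {φ} → QuantifierFreeHorn φ →
                               Degree≥ {Φ = Φ} 1ℚ (φ ⟪ v ⟫) → Below (real (⟦ φ ⟧ v)) 1ℚ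
    QuantifierFreeHorn-value [ h ] d = BasicHorn-value h 1ℚ d
    QuantifierFreeHorn-value (_∧_ {φ} {ψ} h i) d = &ᴵ-intro (⟦ φ ⟧ v) (⟦ ψ ⟧ v)
      (QuantifierFreeHorn-value h (degree-mono ⊢-&₁ d))
      (QuantifierFreeHorn-value i (degree-mono ⊢-&₂ d))

  -- The degree hypothesis concerns `φ` itself, not `φ ⟪ v ⟫`, so substitution is applied only once
  -- the quantifiers are gone and no variable can be captured.
  HornClause-value : Consistent Φ → ∀ {φ} → HornClause φ → Degree≥ {Φ = Φ} 1ℚ φ →
                     ∀ v → Below (real (⟦ φ ⟧ v)) 1ℚ
  HornClause-value cons (qf h) d v =
    QuantifierFreeHorn-value cons v h (degree-⟪⟫ (Conjunction-QF BasicHorn-QF h) v d)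
  HornClause-value cons (all x h) d v =
    ℚₚ.≤-refl , λ t → HornClause-value cons h (degree-mono (∀-elim x) d) (v [ x ↦ t ])

theorem3 : {L : Language} (Φ : Theory L) → Consistent Φ →
    (φ : Formula L) → HornClause φ → Sentence φ →
    ∣ φ ∣[ Φ ] ≈ᴵ 𝟏 → ‖ φ ‖ (TermStructure Φ) ≈ᴵ 𝟏
theorem3 Φ cons φ horn _ ∣φ∣≈𝟏 =
    𝕀.≤1 (‖ φ ‖ (TermStructure Φ))
  , λ q q≤1 → down (real (‖ φ ‖ (TermStructure Φ))) q≤1
      (ℚₚ.≤-refl , HornClause-value Φ cons horn (≈𝟏⇒degree {Φ = Φ} ∣φ∣≈𝟏))
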